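{- In every $4$-total coloring of a cubic graph of order $18$, the color class configuration is one of \[ (12,11,11,11),\qquad (12,12,11,10),\qquad (12,12,12,9). \] All three configurations are attained (each is the color class configuration of some $4$-total coloring of some cubic graph of order $18$). Consequently, the configurations of non-equitable $4$-total colorings of cubic graphs of order $18$ are exactly $(12,12,11,10)$ and $(12,12,12,9)$.
   Context: All graphs are finite, simple and cubic ($3$-regular), not necessarily connected. The order of a graph is its number of vertices. A $4$-total coloring of $G$ assigns one of the four colors $1,2,3,4$ to each vertex and each edge of $G$ so that adjacent vertices receive distinct colors, adjacent edges (edges sharing an endpoint) receive distinct colors, and every vertex and edge that are incident receive distinct colors. The color class $c_i$ is the set of all vertices and edges of color $i$. The color class configuration of the coloring is the multiset $\{|c_1|,|c_2|,|c_3|,|c_4|\}$, written as a non-increasing sequence. The coloring is equitable if $\bigl||c_i|-|c_j|\bigr| \le 1$ for all $i,j \in \{1,2,3,4\}$, and non-equitable otherwise. -}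

module Defs where

open import Data.Fin using (Fin; _<_; _<?_)
open import Data.Fin.Properties using (_≟_)
open import Data.List using (List; _++_; allFin; cartesianProduct; filter; length; map; mapMaybe)
open import Data.List.Sort.InsertionSort using (sort)
open import Data.Maybe using (Maybe)
import Data.Maybe as Maybe
open import Data.Nat as ℕ using (ℕ; ∣_-_∣)
open import Data.Nat.Properties using (≤-decTotalOrder)
open import Data.Product using (_×_; _,_)
open import Data.Sum using (_⊎_; inj₁; inj₂; [_,_])
open import Relation.Binary.Construct.Flip.EqAndOrd using () renaming (decTotalOrder to flipOrder)
open import Relation.Binary.Definitions using (Decidable; Irreflexive; Symmetric)
open import Relation.Binary.PropositionalEquality using (_≡_; _≢_)
open import Relation.Nullary.Decidable using (dec⇒maybe; _×-dec_)

record Graph (n : ℕ) : Set₁ where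
  field
    Adjacent    : Fin n → Fin n → Set
    adjacent?   : Decidable Adjacent
    symmetric   : Symmetric Adjacent
    irreflexive : Irreflexive _≡_ Adjacent

module _ {n : ℕ} (G : Graph n) where
  open Graph G

  degree : Fin n → ℕ
  degree v = length (filter (adjacent? v) (allFin n))

  Cubic : Set
  Cubic = ∀ v → degree v ≡ 3

  -- An undirected edge is represented by its endpoints in increasing order.
  -- The proofs are irrelevant, so an edge is determined by its endpoints.
  record Edge : Set where
    constructor edge
    field
      lo hi     : Fin n
      .lo<hi    : lo < hi
      .adjacent : Adjacent lo hi

  Incident : Fin n → Edge → Set
  Incident v e = v ≡ Edge.lo e ⊎ v ≡ Edge.hi e

  toEdge : Fin n × Fin n → Maybe Edge
  toEdge (u , v) =
    Maybe.map (λ (u<v , uv) → edge u v u<v uv) (dec⇒maybe (u <? v ×-dec adjacent? u v))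

  edges : List Edge
  edges = mapMaybe toEdge (cartesianProduct (allFin n) (allFin n))

  elements : List (Fin n ⊎ Edge)
  elements = map inj₁ (allFin n) ++ map inj₂ edges

  record TotalColouring (k : ℕ) : Set where
    field
      vertexColour    : Fin n → Fin k
      edgeColour      : Edge → Fin k
      vertices-proper : ∀ u v → Adjacent u v → vertexColour u ≢ vertexColour v
      edges-proper    : ∀ v e f → e ≢ f → Incident v e → Incident v f →
                        edgeColour e ≢ edgeColour f
      incident-proper : ∀ v e → Incident v e → vertexColour v ≢ edgeColour e

    colour : Fin n ⊎ Edge → Fin k
    colour = [ vertexColour , edgeColour ]

module _ {n k : ℕ} {G : Graph n} (χ : TotalColouring G k) where
  open TotalColouring χ

  colourClass : Fin k → List (Fin n ⊎ Edge G)
  colourClass i = filter (λ x → colour x ≟ i) (elements G)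

  classSize : Fin k → ℕ
  classSize i = length (colourClass i)

  -- Sorting with respect to ≥ gives the non-increasing sequence of class sizes.
  configuration : List ℕ
  configuration = sort (flipOrder ≤-decTotalOrder) (map classSize (allFin k))

  Equitable : Set
  Equitable = ∀ i j → ∣ classSize i - classSize j ∣ ℕ.≤ 1

{-# OPTIONS --safe #-}

-- At a cubic vertex each of the four colours occurs exactly once, so vᵢ + 2eᵢ = n for the numbers vᵢ, eᵢ of
-- vertices and edges of colour i. The 3vᵢ edges at the vertices of colour i are distinct and avoid colour i, so
-- 3vᵢ + eᵢ ≤ 3n/2. For n = 18 this gives class sizes 9 + kᵢ with vᵢ = 2kᵢ and kᵢ ≤ 3; they add up to 18 + 27, so
-- the kᵢ add up to 9, which leaves (3,2,2,2), (3,3,2,1) and (3,3,3,0). Explicit colourings attain all three.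

module Submission where

open import Defs
open import Data.Bool using (if_then_else_)
open import Data.Fin as Fin using (Fin; toℕ; fromℕ<)
open import Data.Fin.Patterns using (0F; 1F; 2F; 3F)
open import Data.Fin.Properties using (_≟_; _<?_; all?; any?; toℕ-fromℕ<)
import Data.Fin.Properties as Fin
open import Data.List using (List; []; _∷_; _++_; allFin; cartesianProduct; filter; length; map; mapMaybe)
open import Data.List.Membership.Propositional using (_∈_)
open import Data.List.Membership.Propositional.Properties using (∈-allFin; ∈-map⁺; ∈-map⁻)
open import Data.List.Properties using (filter-none; length-++; length-map; length-tabulate; map-cong; map-∘; map-++; ≡-dec)
open import Data.List.Relation.Binary.Permutation.Propositional using (↭-sym)
open import Data.List.Relation.Binary.Permutation.Propositional.Properties using (∈-resp-↭)
open import Data.List.Relation.Unary.All as All using (All; []; _∷_)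
import Data.List.Relation.Unary.All.Properties as All
open import Data.List.Relation.Unary.AllPairs as AllPairs using (AllPairs; []; _∷_)
import Data.List.Relation.Unary.AllPairs.Properties as AllPairs
open import Data.List.Relation.Unary.Any using (here; there)
open import Data.List.Relation.Unary.Unique.Propositional using (Unique)
open import Data.List.Relation.Unary.Unique.Propositional.Properties using (allFin⁺)
open import Data.List.Sort.InsertionSort using (sort)
open import Data.List.Sort.InsertionSort.Properties using (sort-↭)
open import Data.Maybe using (Maybe; just; nothing; maybe; _<∣>_)
import Data.Maybe.Relation.Unary.All as Maybe
open import Data.Nat as ℕ using (ℕ; suc; _+_; _*_; _≤_; _<_; z≤n; s≤s; ∣_-_∣)
open import Data.Nat.DivMod using (_mod_)
open import Data.Nat.ListAction using (sum)
open import Data.Nat.ListAction.Properties using (sum-++)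
open import Data.Nat.Properties hiding (_≟_; _<?_)
open import Data.Nat.Tactic.RingSolver using (solve-∀)
open import Data.Product using (_×_; _,_; ∃; Σ-syntax; proj₁; proj₂; map₂)
open import Data.Sum using (_⊎_; inj₁; inj₂; [_,_]′)
open import Data.Vec as Vec using (Vec; []; _∷_; lookup)
open import Function using (_⇔_; mk⇔; _∘_; id)
open import Relation.Binary.Construct.Flip.EqAndOrd using () renaming (decTotalOrder to flipOrder)
open import Relation.Binary.PropositionalEquality
open import Relation.Nullary using (Dec; yes; no; does; ¬_; contradiction; contradiction-irr)
open import Relation.Nullary.Decidable using (from-yes; from-no; recompute; ¬?; _×-dec_; _⊎-dec_; _→-dec_)
open import Relation.Unary using (Pred; Decidable)

private variable
  A B : Set

-- Finite sums and indicators

∑ : List A → (A → ℕ) → ℕ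
∑ xs f = sum (map f xs)

𝟙 : Dec A → ℕ
𝟙 a? = if does a? then 1 else 0

∑-cong : ∀ {f g : A → ℕ} → f ≗ g → ∀ xs → ∑ xs f ≡ ∑ xs g
∑-cong f≗g xs = cong sum (map-cong f≗g xs)

∑-++ : ∀ (f : A → ℕ) xs ys → ∑ (xs ++ ys) f ≡ ∑ xs f + ∑ ys f
∑-++ f xs ys = trans (cong sum (map-++ f xs ys)) (sum-++ (map f xs) (map f ys))

∑-map : ∀ (f : B → ℕ) (g : A → B) xs → ∑ (map g xs) f ≡ ∑ xs (f ∘ g)
∑-map f g xs = cong sum (sym (map-∘ xs))

∑-+ : ∀ (f g : A → ℕ) xs → ∑ xs (λ x → f x + g x) ≡ ∑ xs f + ∑ xs g
∑-+ f g []       = refl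
∑-+ f g (x ∷ xs) = trans (cong (f x + g x +_) (∑-+ f g xs)) (interchange (f x) (g x) (∑ xs f) (∑ xs g))
  where
  interchange : ∀ a b c d → a + b + (c + d) ≡ a + c + (b + d)
  interchange = solve-∀

∑-* : ∀ c (f : A → ℕ) xs → ∑ xs (λ x → c * f x) ≡ c * ∑ xs f
∑-* c f []       = sym (*-zeroʳ c)
∑-* c f (x ∷ xs) = trans (cong (c * f x +_) (∑-* c f xs)) (sym (*-distribˡ-+ c (f x) (∑ xs f)))

∑-const : ∀ c (xs : List A) → ∑ xs (λ _ → c) ≡ length xs * c
∑-const c []       = refl
∑-const c (x ∷ xs) = cong (c +_) (∑-const c xs)

∑-mono : ∀ {f g : A → ℕ} → (∀ x → f x ≤ g x) → ∀ xs → ∑ xs f ≤ ∑ xs g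
∑-mono f≤g []       = z≤n
∑-mono f≤g (x ∷ xs) = +-mono-≤ (f≤g x) (∑-mono f≤g xs)

∑-swap : ∀ (f : A → B → ℕ) xs ys → ∑ xs (λ x → ∑ ys (f x)) ≡ ∑ ys (λ y → ∑ xs (λ x → f x y))
∑-swap f []       ys = sym (trans (∑-const 0 ys) (*-zeroʳ (length ys)))
∑-swap f (x ∷ xs) ys = trans (cong (∑ ys (f x) +_) (∑-swap f xs ys)) (sym (∑-+ (f x) _ ys))

∑-cartesianProduct : ∀ (f : A × B → ℕ) xs ys →
                     ∑ (cartesianProduct xs ys) f ≡ ∑ xs (λ x → ∑ ys (λ y → f (x , y)))
∑-cartesianProduct f []       ys = refl
∑-cartesianProduct f (x ∷ xs) ys = trans (∑-++ f (map (x ,_) ys) _)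
  (cong₂ _+_ (∑-map f (x ,_) ys) (∑-cartesianProduct f xs ys))

∑-mapMaybe : ∀ (f : B → ℕ) (p : A → Maybe B) xs → ∑ (mapMaybe p xs) f ≡ ∑ xs (maybe f 0 ∘ p)
∑-mapMaybe f p []       = refl
∑-mapMaybe f p (x ∷ xs) with p x
... | just y  = cong (f y +_) (∑-mapMaybe f p xs)
... | nothing = ∑-mapMaybe f p xs

-- The remaining terms add up to at most `length ys * c`, so the first term cannot fall short of
-- `c`; cancelling it leaves the same equality for the tail.
∑-tight : ∀ {c} {f : A → ℕ} → (∀ x → f x ≤ c) → ∀ xs → ∑ xs f ≡ length xs * c →
          ∀ {x} → x ∈ xs → f x ≡ c
∑-tight {c = c} {f} f≤c (y ∷ ys) eq = λ where
    (here refl) → fy≡c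
    (there x∈)  → ∑-tight f≤c ys (+-cancelˡ-≡ c _ _ (trans (cong (_+ ∑ ys f) (sym fy≡c)) eq)) x∈
  where
  ∑≤ : ∑ ys f ≤ length ys * c
  ∑≤ = ≤-trans (∑-mono f≤c ys) (≤-reflexive (∑-const c ys))
  fy≡c : f y ≡ c
  fy≡c = ≤-antisym (f≤c y) (+-cancelʳ-≤ (length ys * c) c (f y)
           (≤-trans (≤-reflexive (sym eq)) (+-monoʳ-≤ (f y) ∑≤)))

length≡∑ : (xs : List A) → length xs ≡ ∑ xs (λ _ → 1)
length≡∑ xs = sym (trans (∑-const 1 xs) (*-identityʳ (length xs)))

length-allFin : ∀ n → length (allFin n) ≡ n
length-allFin n = length-tabulate (id {A = Fin n})

length-filter≡∑ : ∀ {P : Pred A _} (P? : Decidable P) xs → length (filter P? xs) ≡ ∑ xs (𝟙 ∘ P?)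
length-filter≡∑ P? []       = refl
length-filter≡∑ P? (x ∷ xs) with P? x
... | yes _ = cong suc (length-filter≡∑ P? xs)
... | no  _ = length-filter≡∑ P? xs

-- The hypothesis is phrased with `Maybe.All` so that entries discarded by `p` impose no condition.
AllPairs-mapMaybe⁺ : ∀ {R : B → B → Set} {p : A → Maybe B} {xs} →
                     AllPairs (λ x y → Maybe.All (λ a → Maybe.All (R a) (p y)) (p x)) xs →
                     AllPairs R (mapMaybe p xs)
AllPairs-mapMaybe⁺ []                    = []
AllPairs-mapMaybe⁺ {p = p} {x ∷ _} (r ∷ rs) with p x
... | nothing = AllPairs-mapMaybe⁺ rs
... | just a  = All.mapMaybe⁺ (All.map⁺ (All.map (λ { (Maybe.just q) → q }) r)) ∷ AllPairs-mapMaybe⁺ rs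

-- Multiplicities of colours

multiplicity : ∀ {k} → Fin k → List (Fin k) → ℕ
multiplicity i cs = ∑ cs (λ c → 𝟙 (c ≟ i))

unique⇒multiplicity≤1 : ∀ {k} (i : Fin k) {cs} → Unique cs → multiplicity i cs ≤ 1
unique⇒multiplicity≤1 i [] = z≤n
unique⇒multiplicity≤1 i {c ∷ cs} (c∉cs ∷ cs!) with c ≟ i
... | no  _    = unique⇒multiplicity≤1 i cs!
-- The head has colour `i` itself, so by uniqueness no further entry of the tail has it.
... | yes refl = s≤s (≤-reflexive (trans (sym (length-filter≡∑ (_≟ i) cs))
                   (cong length (filter-none (_≟ i) (All.map (λ c≢d → c≢d ∘ sym) c∉cs)))))

∑-𝟙≟ : (c : Fin 4) → ∑ (allFin 4) (λ i → 𝟙 (c ≟ i)) ≡ 1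
∑-𝟙≟ 0F = refl
∑-𝟙≟ 1F = refl
∑-𝟙≟ 2F = refl
∑-𝟙≟ 3F = refl

∑-multiplicity : (cs : List (Fin 4)) → ∑ (allFin 4) (λ i → multiplicity i cs) ≡ length cs
∑-multiplicity cs = begin
  ∑ (allFin 4) (λ i → multiplicity i cs)            ≡⟨ ∑-swap (λ i c → 𝟙 (c ≟ i)) (allFin 4) cs ⟩
  ∑ cs (λ c → ∑ (allFin 4) (λ i → 𝟙 (c ≟ i)))      ≡⟨ ∑-cong ∑-𝟙≟ cs ⟩
  ∑ cs (λ _ → 1)                                     ≡⟨ length≡∑ cs ⟨
  length cs                                          ∎
  where open ≡-Reasoning

-- Pigeonhole: four multiplicities, each at most 1, add up to 4.
multiplicity≡1 : ∀ {cs : List (Fin 4)} → Unique cs → length cs ≡ 4 → ∀ i → multiplicity i cs ≡ 1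
multiplicity≡1 {cs} cs! len i =
  ∑-tight (λ i → unique⇒multiplicity≤1 i cs!) (allFin 4) (trans (∑-multiplicity cs) len) (∈-allFin i)

-- Edges at a vertex

module _ {n : ℕ} (G : Graph n) where
  open Graph G

  private
    V : List (Fin n)
    V = allFin n

  -- Edges are stored with increasing endpoints, so both orders are tried to find the edge joining
  -- `v` and `u`.
  between : Fin n → Fin n → Maybe (Edge G)
  between v u = toEdge G (v , u) <∣> toEdge G (u , v)

  star : Fin n → List (Edge G)
  star v = mapMaybe (between v) V

  -- A view of `between` recording which end of the edge `v` is, so that later proofs need not
  -- compare the endpoints again.
  data Between (v u : Fin n) : Maybe (Edge G) → Set where
    outward : .(v<u : v Fin.< u) .(vu : Adjacent v u) → Between v u (just (edge v u v<u vu))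
    inward  : .(u<v : u Fin.< v) .(uv : Adjacent u v) → Between v u (just (edge u v u<v uv))
    none    : ¬ Adjacent v u → Between v u nothing

  between-view : ∀ v u → Between v u (between v u)
  between-view v u with v <? u ×-dec adjacent? v u
  ... | yes (v<u , vu) = outward v<u vu
  ... | no  ¬vu with u <? v ×-dec adjacent? u v
  ...   | yes (u<v , uv) = inward u<v uv
  -- For adjacent `v` and `u`, the failure of the inward order gives `v ≤ u`, and irreflexivity
  -- makes this strict; but the outward order failed too.
  ...   | no  ¬uv = none λ vu → ¬vu (≤∧≢⇒< (≮⇒≥ λ u<v → ¬uv (u<v , symmetric vu))
                                              (λ v≡u → irreflexive (Fin.toℕ-injective v≡u) vu) , vu)

  -- At most one of the two orientations is an edge, so _<∣>_ adds up.
  maybe-between : ∀ (f : Edge G → ℕ) v u →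
                  maybe f 0 (between v u) ≡ maybe f 0 (toEdge G (v , u)) + maybe f 0 (toEdge G (u , v))
  maybe-between f v u with v <? u ×-dec adjacent? v u
  ... | no _ = refl
  ... | yes (v<u , vu) with u <? v ×-dec adjacent? u v
  ...   | no  _         = sym (+-identityʳ _)
  ...   | yes (u<v , _) = contradiction u<v (<-asym v<u)

  maybe-toEdge : ∀ (w : Fin n → Edge G → ℕ) u v →
                 maybe (w u) 0 (toEdge G (u , v)) + maybe (w v) 0 (toEdge G (u , v)) ≡
                 maybe (λ e → w (Edge.lo e) e + w (Edge.hi e) e) 0 (toEdge G (u , v))
  maybe-toEdge w u v with u <? v ×-dec adjacent? u v
  ... | yes _ = refl
  ... | no  _ = refl

  -- Double counting of incidences: each edge lies in the stars of its lower and its higher end. The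
  -- weight depends on both vertex and edge, so the same identity counts edges, edges of one colour,
  -- and edges at vertices of one colour.
  handshake : (w : Fin n → Edge G → ℕ) →
              ∑ V (λ v → ∑ (star v) (w v)) ≡ ∑ (edges G) (λ e → w (Edge.lo e) e + w (Edge.hi e) e)
  handshake w = begin
    ∑ V (λ v → ∑ (star v) (w v))
      ≡⟨ ∑-cong (λ v → ∑-mapMaybe (w v) (between v) V) V ⟩
    ∑ V (λ v → ∑ V (λ u → maybe (w v) 0 (between v u)))
      ≡⟨ ∑-cong (λ v → trans (∑-cong (maybe-between (w v) v) V) (∑-+ (from v) (to v) V)) V ⟩
    ∑ V (λ v → ∑ V (from v) + ∑ V (to v))
      ≡⟨ ∑-+ (λ v → ∑ V (from v)) (λ v → ∑ V (to v)) V ⟩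
    ∑ V (λ v → ∑ V (from v)) + ∑ V (λ v → ∑ V (to v))
      -- After the swap both sums run over the same ordered pairs, lower end first, and can be
      -- merged.
      ≡⟨ cong (∑ V (λ v → ∑ V (from v)) +_) (∑-swap to V V) ⟩
    ∑ V (λ v → ∑ V (from v)) + ∑ V (λ u → ∑ V (λ v → to v u))
      ≡⟨ ∑-+ (λ v → ∑ V (from v)) (λ u → ∑ V (λ v → to v u)) V ⟨
    ∑ V (λ u → ∑ V (from u) + ∑ V (λ v → to v u))
      ≡⟨ ∑-cong (λ u → trans (sym (∑-+ (from u) (λ v → to v u) V)) (∑-cong (maybe-toEdge w u) V)) V ⟩
    ∑ V (λ u → ∑ V (λ v → maybe ends 0 (toEdge G (u , v))))
      ≡⟨ ∑-cartesianProduct (maybe ends 0 ∘ toEdge G) V V ⟨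
    ∑ (cartesianProduct V V) (maybe ends 0 ∘ toEdge G)
      ≡⟨ ∑-mapMaybe ends (toEdge G) (cartesianProduct V V) ⟨
    ∑ (edges G) ends ∎
    where
    open ≡-Reasoning
    from to : Fin n → Fin n → ℕ
    from v u = maybe (w v) 0 (toEdge G (v , u))
    to   v u = maybe (w v) 0 (toEdge G (u , v))
    ends : Edge G → ℕ
    ends e = w (Edge.lo e) e + w (Edge.hi e) e

  -- `between v u` yields an edge exactly when `u` is a neighbour of `v`.
  length-star : ∀ v → length (star v) ≡ degree G v
  length-star v = begin
    length (star v)                              ≡⟨ length≡∑ (star v) ⟩
    ∑ (star v) (λ _ → 1)                         ≡⟨ ∑-mapMaybe (λ _ → 1) (between v) V ⟩
    ∑ V (λ u → maybe (λ _ → 1) 0 (between v u))  ≡⟨ ∑-cong (λ u → indicator (between-view v u) (adjacent? v u)) V ⟩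
    ∑ V (λ u → 𝟙 (adjacent? v u))                ≡⟨ length-filter≡∑ (adjacent? v) V ⟨
    degree G v                                   ∎
    where
    open ≡-Reasoning
    indicator : ∀ {u m} → Between v u m → (vu? : Dec (Adjacent v u)) → maybe (λ _ → 1) 0 m ≡ 𝟙 vu?
    indicator (outward _ _)  (yes _)  = refl
    indicator (inward  _ _)  (yes _)  = refl
    indicator (none _)       (no _)   = refl
    indicator (none ¬vu)     (yes vu) = contradiction vu ¬vu
    indicator (outward _ vu) (no ¬vu) = contradiction-irr vu ¬vu
    indicator (inward  _ uv) (no ¬vu) = contradiction-irr (symmetric uv) ¬vu

  incident-star : ∀ v → All (Incident G v) (star v)
  incident-star v = All.mapMaybe⁺ {xs = V} (All.map⁺ (All.tabulate λ {u} _ → incident u))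
    where
    incident : ∀ u → Maybe.All (Incident G v) (between v u)
    incident u with between v u | between-view v u
    ... | _ | outward _ _ = Maybe.just (inj₁ refl)
    ... | _ | inward  _ _ = Maybe.just (inj₂ refl)
    ... | _ | none    _   = Maybe.nothing

  unique-star : ∀ v → Unique (star v)
  unique-star v = AllPairs-mapMaybe⁺ {xs = V} (AllPairs.map distinct (allFin⁺ n))
    where
    distinct : ∀ {u u′} → u ≢ u′ → Maybe.All (λ e → Maybe.All (e ≢_) (between v u′)) (between v u)
    distinct {u} {u′} u≢u′ with between v u | between-view v u | between v u′ | between-view v u′
    ... | _ | none _      | _ | _           = Maybe.nothing
    ... | _ | outward _ _ | _ | none _      = Maybe.just Maybe.nothing
    ... | _ | inward  _ _ | _ | none _      = Maybe.just Maybe.nothing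
    ... | _ | outward _ _ | _ | outward _ _ = Maybe.just (Maybe.just (u≢u′ ∘ cong Edge.hi))
    -- With `v` the lower end of one edge and the higher end of the other, equality would make both
    -- `u` and `u′` equal to `v`.
    ... | _ | outward _ _ | _ | inward  _ _ = Maybe.just (Maybe.just λ eq → u≢u′ (trans (cong Edge.hi eq) (cong Edge.lo eq)))
    ... | _ | inward  _ _ | _ | outward _ _ = Maybe.just (Maybe.just λ eq → u≢u′ (trans (cong Edge.lo eq) (cong Edge.hi eq)))
    ... | _ | inward  _ _ | _ | inward  _ _ = Maybe.just (Maybe.just (u≢u′ ∘ cong Edge.lo))

-- Counting colours in a 4-total colouring of a cubic graph

module _ {n : ℕ} {G : Graph n} (cubic : Cubic G) (χ : TotalColouring G 4) where
  open Graph G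
  open TotalColouring χ

  private
    V : List (Fin n)
    V = allFin n

    hasColour : Fin 4 → Fin 4 → ℕ
    hasColour i c = 𝟙 (c ≟ i)

  length-star≡3 : ∀ v → length (star G v) ≡ 3
  length-star≡3 v = trans (length-star G v) (cubic v)

  vertexCount edgeCount : Fin 4 → ℕ
  vertexCount i = ∑ V (λ v → 𝟙 (vertexColour v ≟ i))
  edgeCount   i = ∑ (edges G) (λ e → 𝟙 (edgeColour e ≟ i))

  classSize≡ : ∀ i → classSize χ i ≡ vertexCount i + edgeCount i
  classSize≡ i = begin
    classSize χ i                                               ≡⟨ length-filter≡∑ (λ x → colour x ≟ i) (elements G) ⟩
    ∑ (elements G) f                                            ≡⟨ ∑-++ f (map inj₁ V) (map inj₂ (edges G)) ⟩
    ∑ (map inj₁ V) f + ∑ (map inj₂ (edges G)) f                 ≡⟨ cong₂ _+_ (∑-map f inj₁ V) (∑-map f inj₂ (edges G)) ⟩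
    vertexCount i + edgeCount i                                 ∎
    where
    open ≡-Reasoning
    f : Fin n ⊎ Edge G → ℕ
    f x = 𝟙 (colour x ≟ i)

  ∑-classSize : ∑ (allFin 4) (classSize χ) ≡ n + length (edges G)
  ∑-classSize = begin
    ∑ (allFin 4) (classSize χ)
      ≡⟨ ∑-cong (λ i → trans (length-filter≡∑ (λ x → colour x ≟ i) (elements G))
                                (sym (∑-map (hasColour i) colour (elements G)))) (allFin 4) ⟩
    ∑ (allFin 4) (λ i → multiplicity i (map colour (elements G)))
      ≡⟨ ∑-multiplicity (map colour (elements G)) ⟩
    length (map colour (elements G))
      ≡⟨ trans (length-map colour (elements G)) (length-++ (map inj₁ V)) ⟩
    length {A = Fin n ⊎ Edge G} (map inj₁ V) + length {A = Fin n ⊎ Edge G} (map inj₂ (edges G))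
      ≡⟨ cong₂ _+_ (trans (length-map inj₁ V) (length-allFin n)) (length-map inj₂ (edges G)) ⟩
    n + length (edges G) ∎
    where open ≡-Reasoning

  2*|edges| : 2 * length (edges G) ≡ 3 * n
  2*|edges| = begin
    2 * length (edges G)            ≡⟨ *-comm 2 (length (edges G)) ⟩
    length (edges G) * 2            ≡⟨ ∑-const 2 (edges G) ⟨
    ∑ (edges G) (λ _ → 2)           ≡⟨ handshake G (λ _ _ → 1) ⟨
    ∑ V (λ v → ∑ (star G v) (λ _ → 1)) ≡⟨ ∑-cong (λ v → trans (sym (length≡∑ (star G v))) (length-star≡3 v)) V ⟩
    ∑ V (λ _ → 3)                   ≡⟨ ∑-const 3 V ⟩
    length V * 3                    ≡⟨ cong (_* 3) (length-allFin n) ⟩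
    n * 3                           ≡⟨ *-comm n 3 ⟩
    3 * n                           ∎
    where open ≡-Reasoning

  coloursAt : Fin n → List (Fin 4)
  coloursAt v = vertexColour v ∷ map edgeColour (star G v)

  -- The edges of the star are distinct and all meet `v`, so properness separates their colours from
  -- one another and from the colour of `v`.
  unique-coloursAt : ∀ v → Unique (coloursAt v)
  unique-coloursAt v =
    All.map⁺ (All.map (incident-proper v _) (incident-star G v)) ∷
    AllPairs.map⁺ (proper (incident-star G v) (unique-star G v))
    where
    proper : ∀ {es} → All (Incident G v) es → Unique es → AllPairs (λ e f → edgeColour e ≢ edgeColour f) es
    proper []       []           = []
    proper (i ∷ is) (e∉es ∷ es!) =
      All.zipWith (λ (i′ , e≢f) → edges-proper v _ _ e≢f i i′) (is , e∉es) ∷ proper is es!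

  -- Colour `i` is seen exactly once at each vertex: a vertex of that colour is seen only from
  -- itself, an edge of that colour from both of its ends.
  vertexCount+2*edgeCount : ∀ i → vertexCount i + 2 * edgeCount i ≡ n
  vertexCount+2*edgeCount i = begin
    vertexCount i + 2 * edgeCount i
      ≡⟨ cong (vertexCount i +_) (∑-* 2 hue (edges G)) ⟨
    vertexCount i + ∑ (edges G) (λ e → 2 * hue e)
      ≡⟨ cong (vertexCount i +_) (∑-cong (λ e → cong (hue e +_) (+-identityʳ (hue e))) (edges G)) ⟩
    vertexCount i + ∑ (edges G) (λ e → hue e + hue e)
      ≡⟨ cong (vertexCount i +_) (handshake G (λ _ → hue)) ⟨
    vertexCount i + ∑ V (λ v → ∑ (star G v) hue)
      ≡⟨ ∑-+ (λ v → 𝟙 (vertexColour v ≟ i)) (λ v → ∑ (star G v) hue) V ⟨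
    ∑ V (λ v → 𝟙 (vertexColour v ≟ i) + ∑ (star G v) hue)
      ≡⟨ ∑-cong (λ v → cong (𝟙 (vertexColour v ≟ i) +_) (∑-map (hasColour i) edgeColour (star G v))) V ⟨
    ∑ V (λ v → multiplicity i (coloursAt v))
      ≡⟨ ∑-cong (λ v → multiplicity≡1 (unique-coloursAt v)
           (cong suc (trans (length-map edgeColour (star G v)) (length-star≡3 v))) i) V ⟩
    ∑ V (λ _ → 1)
      ≡⟨ length≡∑ V ⟨
    length V
      ≡⟨ length-allFin n ⟩
    n ∎
    where
    open ≡-Reasoning
    hue : Edge G → ℕ
    hue e = 𝟙 (edgeColour e ≟ i)

  -- Each vertex of colour `i` charges its three edges, and each edge of colour `i` charges itself.
  -- An edge and its two ends have pairwise distinct colours, so no edge is charged twice.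
  3*vertexCount+edgeCount : ∀ i → 3 * vertexCount i + edgeCount i ≤ length (edges G)
  3*vertexCount+edgeCount i = begin
    3 * vertexCount i + edgeCount i
      ≡⟨ cong (_+ edgeCount i) (∑-* 3 hue V) ⟨
    ∑ V (λ v → 3 * hue v) + edgeCount i
      ≡⟨ cong (_+ edgeCount i) (∑-cong (λ v → trans (∑-const (hue v) (star G v)) (cong (_* hue v) (length-star≡3 v))) V) ⟨
    ∑ V (λ v → ∑ (star G v) (λ _ → hue v)) + edgeCount i
      ≡⟨ cong (_+ edgeCount i) (handshake G (λ v _ → hue v)) ⟩
    ∑ (edges G) (λ e → hue (Edge.lo e) + hue (Edge.hi e)) + edgeCount i
      ≡⟨ ∑-+ (λ e → hue (Edge.lo e) + hue (Edge.hi e)) (λ e → 𝟙 (edgeColour e ≟ i)) (edges G) ⟨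
    ∑ (edges G) (λ e → hue (Edge.lo e) + hue (Edge.hi e) + 𝟙 (edgeColour e ≟ i))
      ≤⟨ ∑-mono at-most-once (edges G) ⟩
    ∑ (edges G) (λ _ → 1)
      ≡⟨ length≡∑ (edges G) ⟨
    length (edges G) ∎
    where
    open ≤-Reasoning
    hue : Fin n → ℕ
    hue v = 𝟙 (vertexColour v ≟ i)
    at-most-once : ∀ e → hue (Edge.lo e) + hue (Edge.hi e) + 𝟙 (edgeColour e ≟ i) ≤ 1
    at-most-once e@(edge u v u<v uv) = ≤-trans
      (≤-reflexive (rearrange (hue u) (hue v) (𝟙 (edgeColour e ≟ i))))
      (unique⇒multiplicity≤1 i {vertexColour u ∷ vertexColour v ∷ edgeColour e ∷ []}
        ((vertices-proper u v (recompute (adjacent? u v) uv) ∷ incident-proper u e (inj₁ refl) ∷ []) ∷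
         (incident-proper v e (inj₂ refl) ∷ []) ∷ [] ∷ []))
      where
      rearrange : ∀ a b c → a + b + c ≡ a + (b + (c + 0))
      rearrange = solve-∀

-- Order 18

-- The equation makes `v` even, `v = 2k` with `k = 9 - e`. Doubling the inequality and splitting off
-- `v + 2e = 18` leaves `5v ≤ 36`, that is `10k ≤ 36`, hence `k < 4`.
excess-bounded : ∀ v e m → v + 2 * e ≡ 18 → 3 * v + e ≤ m → 2 * m ≡ 54 → Σ[ k ∈ Fin 4 ] v + e ≡ 9 + toℕ k
excess-bounded v e m v+2e 3v+e≤m 2m = fromℕ< k<4 , (begin
  v + e                      ≡⟨ cong (_+ e) v≡2k ⟩
  2 * k + e                  ≡⟨ rearrange k e ⟩
  e + k + k                  ≡⟨ cong (_+ k) e+k≡9 ⟩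
  9 + k                      ≡⟨ cong (9 +_) (toℕ-fromℕ< k<4) ⟨
  9 + toℕ (fromℕ< k<4)       ∎)
  where
  open ≡-Reasoning
  rearrange : ∀ k e → 2 * k + e ≡ e + k + k
  rearrange = solve-∀
  5v+18 : ∀ v e → 5 * v + (v + 2 * e) ≡ 2 * (3 * v + e)
  5v+18 = solve-∀
  e≤9 : e ≤ 9
  e≤9 = *-cancelˡ-≤ 2 (≤-trans (m≤n+m (2 * e) v) (≤-reflexive v+2e))
  k : ℕ
  k = 9 ℕ.∸ e
  e+k≡9 : e + k ≡ 9
  e+k≡9 = m+[n∸m]≡n e≤9
  v≡2k : v ≡ 2 * k
  v≡2k = +-cancelʳ-≡ (2 * e) v (2 * k) (trans v+2e
    (sym (trans (sym (*-distribˡ-+ 2 k e)) (cong (2 *_) (trans (+-comm k e) e+k≡9)))))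
  5v+18≤54 : 5 * v + 18 ≤ 54
  5v+18≤54 = subst₂ _≤_ (trans (sym (5v+18 v e)) (cong (5 * v +_) v+2e)) 2m (*-monoʳ-≤ 2 3v+e≤m)
  10k≤36 : 10 * k ≤ 36
  10k≤36 = subst (_≤ 36) (trans (cong (5 *_) v≡2k) (sym (*-assoc 5 2 k)))
             (+-cancelʳ-≤ 18 (5 * v) 36 5v+18≤54)
  k<4 : k < 4
  k<4 = *-cancelˡ-< 10 k 4 (≤-trans (s≤s 10k≤36) (from-yes (37 ℕ.≤? 40)))

Admissible : List ℕ → Set
Admissible c = c ≡ 12 ∷ 11 ∷ 11 ∷ 11 ∷ [] ⊎ c ≡ 12 ∷ 12 ∷ 11 ∷ 10 ∷ [] ⊎ c ≡ 12 ∷ 12 ∷ 12 ∷ 9 ∷ []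

admissible? : ∀ c → Dec (Admissible c)
admissible? c = c ≟ₗ 12 ∷ 11 ∷ 11 ∷ 11 ∷ [] ⊎-dec c ≟ₗ 12 ∷ 12 ∷ 11 ∷ 10 ∷ [] ⊎-dec c ≟ₗ 12 ∷ 12 ∷ 12 ∷ 9 ∷ []
  where
  infix 4 _≟ₗ_
  _≟ₗ_ = ≡-dec ℕ._≟_

descending : List ℕ → List ℕ
descending = sort (flipOrder ≤-decTotalOrder)

sizes : (a b c d : Fin 4) → List ℕ
sizes a b c d = map (λ k → 9 + toℕ k) (a ∷ b ∷ c ∷ d ∷ [])

-- Only 256 quadruples of excesses remain, few enough to be decided by evaluation.
sizes-admissible? : Dec (∀ a b c d → sum (sizes a b c d) ≡ 45 → Admissible (descending (sizes a b c d)))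
sizes-admissible? = all? λ a → all? λ b → all? λ c → all? λ d →
  sum (sizes a b c d) ℕ.≟ 45 →-dec admissible? (descending (sizes a b c d))

sizes-admissible : ∀ a b c d → sum (sizes a b c d) ≡ 45 → Admissible (descending (sizes a b c d))
sizes-admissible = from-yes sizes-admissible?

sort-admissible : (f : Fin 4 → ℕ) → (∀ i → Σ[ k ∈ Fin 4 ] f i ≡ 9 + toℕ k) → ∑ (allFin 4) f ≡ 45 →
                  Admissible (descending (map f (allFin 4)))
sort-admissible f excess ∑≡45 =
  subst Admissible (cong descending (sym sizes≡))
    (sizes-admissible (k 0F) (k 1F) (k 2F) (k 3F) (trans (cong sum (sym sizes≡)) ∑≡45))
  where
  k : Fin 4 → Fin 4
  k = proj₁ ∘ excess
  sizes≡ : map f (allFin 4) ≡ sizes (k 0F) (k 1F) (k 2F) (k 3F)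
  sizes≡ = map-cong (proj₂ ∘ excess) (allFin 4)

configuration-admissible : {G : Graph 18} → Cubic G → (χ : TotalColouring G 4) → Admissible (configuration χ)
configuration-admissible {G} cubic χ = sort-admissible (classSize χ) excess ∑≡45
  where
  excess : ∀ i → Σ[ k ∈ Fin 4 ] classSize χ i ≡ 9 + toℕ k
  excess i = map₂ (trans (classSize≡ cubic χ i))
    (excess-bounded (vertexCount cubic χ i) (edgeCount cubic χ i) (length (edges G))
      (vertexCount+2*edgeCount cubic χ i) (3*vertexCount+edgeCount cubic χ i) (2*|edges| cubic χ))
  ∑≡45 : ∑ (allFin 4) (classSize χ) ≡ 45
  -- Of the 45 elements, 18 are vertices and 27 are edges, since twice the number of edges is 54.
  ∑≡45 = trans (∑-classSize cubic χ) (cong (18 +_) (*-cancelˡ-≡ _ 27 2 (2*|edges| cubic χ)))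

-- Equitability read off from the configuration

Spread≤1 : List ℕ → Set
Spread≤1 c = All (λ a → All (λ b → ∣ a - b ∣ ≤ 1) c) c

spread≤1? : ∀ c → Dec (Spread≤1 c)
spread≤1? c = All.all? (λ a → All.all? (λ b → ∣ a - b ∣ ℕ.≤? 1) c) c

module _ {n k : ℕ} {G : Graph n} (χ : TotalColouring G k) where

  -- Sorting only permutes the class sizes, so conditions on all pairs of sizes can be moved between
  -- the colouring and its configuration.
  classSize∈configuration : ∀ i → classSize χ i ∈ configuration χ
  classSize∈configuration i = ∈-resp-↭ (↭-sym (sort-↭ _ _)) (∈-map⁺ (classSize χ) (∈-allFin i))

  spread≤1⇒equitable : Spread≤1 (configuration χ) → Equitable χ
  spread≤1⇒equitable spread i j =
    All.lookup (All.lookup spread (classSize∈configuration i)) (classSize∈configuration j)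

  equitable⇒spread≤1 : Equitable χ → Spread≤1 (configuration χ)
  equitable⇒spread≤1 equitable = All.tabulate λ a∈ → All.tabulate λ b∈ → close a∈ b∈
    where
    size : ∀ {a} → a ∈ configuration χ → ∃ λ i → a ≡ classSize χ i
    size a∈ with i , _ , eq ← ∈-map⁻ (classSize χ) {xs = allFin k} (∈-resp-↭ (sort-↭ _ _) a∈) = i , eq
    close : ∀ {a b} → a ∈ configuration χ → b ∈ configuration χ → ∣ a - b ∣ ≤ 1
    close a∈ b∈ with size a∈ | size b∈
    ... | i , refl | j , refl = equitable i j

-- Colourings from matchings

-- A total k-colouring of a (k ∸ 1)-regular graph is encoded by k involutions: the i-th swaps the ends of
-- every edge of colour i and fixes the vertices of colour i.
module Matchings {n k : ℕ} (partner : Fin k → Fin n → Fin n) (vertexColour : Fin n → Fin k) where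

  -- The second condition rules out parallel edges; with the third, it makes the colour of `v` the
  -- only one whose involution fixes `v`. The fourth keeps adjacent vertices from sharing a colour.
  Valid : Set
  Valid = (∀ i v → partner i (partner i v) ≡ v)
        × (∀ v i j → partner i v ≡ partner j v → i ≡ j)
        × (∀ v → partner (vertexColour v) v ≡ v)
        × (∀ i v → vertexColour v ≡ vertexColour (partner i v) → v ≡ partner i v)

  valid? : Dec Valid
  valid? = (all? λ i → all? λ v → partner i (partner i v) ≟ v)
     ×-dec (all? λ v → all? λ i → all? λ j → partner i v ≟ partner j v →-dec i ≟ j)
     ×-dec (all? λ v → partner (vertexColour v) v ≟ v)
     ×-dec (all? λ i → all? λ v → vertexColour v ≟ vertexColour (partner i v) →-dec v ≟ partner i v)

  module _ (valid : Valid) where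
    private
      involutive = proj₁ valid
      simple     = proj₁ (proj₂ valid)
      fixes      = proj₁ (proj₂ (proj₂ valid))
      proper     = proj₂ (proj₂ (proj₂ valid))

    partner-swap : ∀ {i u v} → partner i u ≡ v → partner i v ≡ u
    partner-swap {i} refl = involutive i _

    graph : Graph n
    graph = record
      -- Fixed points of the involutions encode vertex colours and must not become loops.
      { Adjacent    = λ u v → u ≢ v × ∃ λ i → partner i u ≡ v
      ; adjacent?   = λ u v → ¬? (u ≟ v) ×-dec any? λ i → partner i u ≟ v
      ; symmetric   = λ (u≢v , i , eq) → u≢v ∘ sym , i , partner-swap eq
      ; irreflexive = λ u≡v (u≢v , _) → u≢v u≡v
      }

    -- An edge holds its adjacency only irrelevantly; deciding it again produces an actual index
    -- `i`, from which the edge colour is read off.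
    adjacency : (e : Edge graph) → Graph.Adjacent graph (Edge.lo e) (Edge.hi e)
    adjacency (edge u v _ uv) = recompute (Graph.adjacent? graph u v) uv

    edgeColour : Edge graph → Fin k
    edgeColour e = proj₁ (proj₂ (adjacency e))

    lo→hi : ∀ e → partner (edgeColour e) (Edge.lo e) ≡ Edge.hi e
    lo→hi e = proj₂ (proj₂ (adjacency e))

    hi→lo : ∀ e → partner (edgeColour e) (Edge.hi e) ≡ Edge.lo e
    hi→lo e = partner-swap (lo→hi e)

    edge-≡ : ∀ {e f : Edge graph} → Edge.lo e ≡ Edge.lo f → Edge.hi e ≡ Edge.hi f → e ≡ f
    edge-≡ refl refl = refl

    not-reversed : ∀ (e f : Edge graph) → Edge.lo e ≡ Edge.hi f → Edge.hi e ≢ Edge.lo f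
    not-reversed (edge u v u<v _) (edge _ _ v<u _) refl refl = <-asym (recompute (u <? v) u<v) (recompute (v <? u) v<u)

    -- The involution of the common colour determines the other end of each edge from the shared
    -- vertex `v`.
    same-colour⇒≡ : ∀ {v} e f → Incident graph v e → Incident graph v f → edgeColour e ≡ edgeColour f → e ≡ f
    same-colour⇒≡ e f (inj₁ refl) (inj₁ eq) c =
      edge-≡ eq (trans (sym (lo→hi e)) (trans (cong₂ partner c eq) (lo→hi f)))
    same-colour⇒≡ e f (inj₂ refl) (inj₂ eq) c =
      edge-≡ (trans (sym (hi→lo e)) (trans (cong₂ partner c eq) (hi→lo f))) eq
    -- Here `v` is the lower end of `e` and the higher end of `f`, so the edges would be reverses of
    -- each other, against the increasing order of endpoints.
    same-colour⇒≡ e f (inj₁ refl) (inj₂ eq) c =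
      contradiction (trans (sym (lo→hi e)) (trans (cong₂ partner c eq) (hi→lo f))) (not-reversed e f eq)
    same-colour⇒≡ e f (inj₂ refl) (inj₁ eq) c =
      contradiction (trans (sym (lo→hi f)) (trans (cong₂ partner (sym c) (sym eq)) (hi→lo e))) (not-reversed f e (sym eq))

    ends-distinct : ∀ e → Edge.lo e ≢ Edge.hi e
    ends-distinct e = proj₁ (adjacency e)

    -- The involution of its own colour fixes `v`, so an edge of that colour at `v` would have equal
    -- ends.
    incident-proper : ∀ v e → Incident graph v e → vertexColour v ≢ edgeColour e
    incident-proper v e (inj₁ refl) c = ends-distinct e
      (trans (sym (fixes v)) (trans (cong (λ i → partner i v) c) (lo→hi e)))
    incident-proper v e (inj₂ refl) c = ends-distinct e
      (sym (trans (sym (fixes v)) (trans (cong (λ i → partner i v) c) (hi→lo e))))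

    colouring : TotalColouring graph k
    colouring = record
      { vertexColour    = vertexColour
      ; edgeColour      = edgeColour
      ; vertices-proper = λ { u _ (u≢v , i , refl) c → u≢v (proper i u c) }
      ; edges-proper    = λ v e f e≢f v∈e v∈f c → e≢f (same-colour⇒≡ e f v∈e v∈f c)
      ; incident-proper = incident-proper
      }

-- The subscripts are the numbers of vertices of the four colours.
colours₆₄₄₄ : Vec (Fin 4) 18
colours₆₄₄₄ = Vec.replicate 6 0F Vec.++ Vec.replicate 4 1F Vec.++ Vec.replicate 4 2F Vec.++ Vec.replicate 4 3F

partners₆₄₄₄ : Vec (Vec ℕ 18) 4
partners₆₄₄₄ =
    (0 ∷ 1 ∷ 2 ∷ 3 ∷ 4 ∷ 5 ∷ 14 ∷ 13 ∷ 17 ∷ 12 ∷ 16 ∷ 15 ∷ 9 ∷ 7 ∷ 6 ∷ 11 ∷ 10 ∷ 8 ∷ [])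
  ∷ (13 ∷ 10 ∷ 12 ∷ 15 ∷ 14 ∷ 16 ∷ 6 ∷ 7 ∷ 8 ∷ 9 ∷ 1 ∷ 17 ∷ 2 ∷ 0 ∷ 4 ∷ 3 ∷ 5 ∷ 11 ∷ [])
  ∷ (7 ∷ 6 ∷ 9 ∷ 17 ∷ 15 ∷ 14 ∷ 1 ∷ 0 ∷ 16 ∷ 2 ∷ 10 ∷ 11 ∷ 12 ∷ 13 ∷ 5 ∷ 4 ∷ 8 ∷ 3 ∷ [])
  ∷ (10 ∷ 12 ∷ 8 ∷ 13 ∷ 9 ∷ 6 ∷ 5 ∷ 11 ∷ 2 ∷ 4 ∷ 0 ∷ 7 ∷ 1 ∷ 3 ∷ 14 ∷ 15 ∷ 16 ∷ 17 ∷ [])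
  ∷ []

colours₆₆₄₂ : Vec (Fin 4) 18
colours₆₆₄₂ = Vec.replicate 6 0F Vec.++ Vec.replicate 6 1F Vec.++ Vec.replicate 4 2F Vec.++ Vec.replicate 2 3F

partners₆₆₄₂ : Vec (Vec ℕ 18) 4
partners₆₆₄₂ =
    (0 ∷ 1 ∷ 2 ∷ 3 ∷ 4 ∷ 5 ∷ 16 ∷ 12 ∷ 17 ∷ 15 ∷ 14 ∷ 13 ∷ 7 ∷ 11 ∷ 10 ∷ 9 ∷ 6 ∷ 8 ∷ [])
  ∷ (17 ∷ 15 ∷ 12 ∷ 14 ∷ 13 ∷ 16 ∷ 6 ∷ 7 ∷ 8 ∷ 9 ∷ 10 ∷ 11 ∷ 2 ∷ 4 ∷ 3 ∷ 1 ∷ 5 ∷ 0 ∷ [])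
  ∷ (7 ∷ 6 ∷ 16 ∷ 8 ∷ 10 ∷ 11 ∷ 1 ∷ 0 ∷ 3 ∷ 17 ∷ 4 ∷ 5 ∷ 12 ∷ 13 ∷ 14 ∷ 15 ∷ 2 ∷ 9 ∷ [])
  ∷ (9 ∷ 12 ∷ 10 ∷ 7 ∷ 8 ∷ 13 ∷ 15 ∷ 3 ∷ 4 ∷ 0 ∷ 2 ∷ 14 ∷ 1 ∷ 5 ∷ 11 ∷ 6 ∷ 16 ∷ 17 ∷ [])
  ∷ []

colours₆₆₆₀ : Vec (Fin 4) 18
colours₆₆₆₀ = Vec.replicate 6 0F Vec.++ Vec.replicate 6 1F Vec.++ Vec.replicate 6 2F

-- No vertex has the fourth colour, so the last row is a perfect matching; its nine edges form the
-- class of size 9.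
partners₆₆₆₀ : Vec (Vec ℕ 18) 4
partners₆₆₆₀ =
    (0 ∷ 1 ∷ 2 ∷ 3 ∷ 4 ∷ 5 ∷ 16 ∷ 12 ∷ 17 ∷ 15 ∷ 14 ∷ 13 ∷ 7 ∷ 11 ∷ 10 ∷ 9 ∷ 6 ∷ 8 ∷ [])
  ∷ (17 ∷ 15 ∷ 12 ∷ 14 ∷ 13 ∷ 16 ∷ 6 ∷ 7 ∷ 8 ∷ 9 ∷ 10 ∷ 11 ∷ 2 ∷ 4 ∷ 3 ∷ 1 ∷ 5 ∷ 0 ∷ [])
  ∷ (7 ∷ 8 ∷ 10 ∷ 6 ∷ 11 ∷ 9 ∷ 3 ∷ 0 ∷ 1 ∷ 5 ∷ 2 ∷ 4 ∷ 12 ∷ 13 ∷ 14 ∷ 15 ∷ 16 ∷ 17 ∷ [])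
  ∷ (12 ∷ 14 ∷ 7 ∷ 9 ∷ 8 ∷ 13 ∷ 15 ∷ 2 ∷ 4 ∷ 3 ∷ 16 ∷ 17 ∷ 0 ∷ 5 ∷ 1 ∷ 6 ∷ 10 ∷ 11 ∷ [])
  ∷ []

module Example (colours : Vec (Fin 4) 18) (partners : Vec (Vec ℕ 18) 4) where
  -- All entries of the tables are below 18, so `mod 18` merely turns them into elements of
  -- `Fin 18`.
  open Matchings (λ i v → lookup (lookup partners i) v mod 18) (lookup colours) public

  cubic? : ∀ valid → Dec (Cubic (graph valid))
  cubic? valid = all? λ v → degree (graph valid) v ℕ.≟ 3

module Example₆₄₄₄ = Example colours₆₄₄₄ partners₆₄₄₄
module Example₆₆₄₂ = Example colours₆₆₄₂ partners₆₆₄₂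
module Example₆₆₆₀ = Example colours₆₆₆₀ partners₆₆₆₀

Attained : List ℕ → Set₁
Attained c = Σ[ G ∈ Graph 18 ] Cubic G × (Σ[ χ ∈ TotalColouring G 4 ] configuration χ ≡ c)

valid₆₄₄₄ : Example₆₄₄₄.Valid
valid₆₄₄₄ = from-yes Example₆₄₄₄.valid?

valid₆₆₄₂ : Example₆₆₄₂.Valid
valid₆₆₄₂ = from-yes Example₆₆₄₂.valid?

valid₆₆₆₀ : Example₆₆₆₀.Valid
valid₆₆₆₀ = from-yes Example₆₆₆₀.valid?

-- A colour with `v` vertices has `9 - v/2` edges, so 6, 4, 2 and 0 vertices give class sizes 12,
-- 11, 10 and 9.
attained₆₄₄₄ : Attained (12 ∷ 11 ∷ 11 ∷ 11 ∷ [])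
attained₆₄₄₄ = graph valid₆₄₄₄ , from-yes (cubic? valid₆₄₄₄) , colouring valid₆₄₄₄ , refl
  where open Example₆₄₄₄

attained₆₆₄₂ : Attained (12 ∷ 12 ∷ 11 ∷ 10 ∷ [])
attained₆₆₄₂ = graph valid₆₆₄₂ , from-yes (cubic? valid₆₆₄₂) , colouring valid₆₆₄₂ , refl
  where open Example₆₆₄₂

attained₆₆₆₀ : Attained (12 ∷ 12 ∷ 12 ∷ 9 ∷ [])
attained₆₆₆₀ = graph valid₆₆₆₀ , from-yes (cubic? valid₆₆₆₀) , colouring valid₆₆₆₀ , refl
  where open Example₆₆₆₀

-- Configurations of non-equitable colourings

¬spread≤1⇒¬equitable : ∀ {n k} {G : Graph n} {χ : TotalColouring G k} {c} →
                       configuration χ ≡ c → ¬ Spread≤1 c → ¬ Equitable χ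
¬spread≤1⇒¬equitable {χ = χ} refl ¬spread = ¬spread ∘ equitable⇒spread≤1 χ

-- Of the three admissible configurations, the first has spread 1 and so forces equitability.
non-equitable-configuration : {G : Graph 18} → Cubic G → (χ : TotalColouring G 4) → ¬ Equitable χ →
  configuration χ ≡ 12 ∷ 12 ∷ 11 ∷ 10 ∷ [] ⊎ configuration χ ≡ 12 ∷ 12 ∷ 12 ∷ 9 ∷ []
non-equitable-configuration cubic χ ¬equitable = [ (λ conf → contradiction (equitable conf) ¬equitable) , id ]′
  (configuration-admissible cubic χ)
  where
  equitable : configuration χ ≡ 12 ∷ 11 ∷ 11 ∷ 11 ∷ [] → Equitable χ
  equitable conf = spread≤1⇒equitable χ (subst Spread≤1 (sym conf) (from-yes (spread≤1? (12 ∷ 11 ∷ 11 ∷ 11 ∷ []))))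

-- The colouring attaining `c` already serves, as its failure to be equitable is visible from `c`
-- alone.
attained-non-equitably : ∀ {c} → ¬ Spread≤1 c → Attained c →
  Σ[ G ∈ Graph 18 ] Cubic G × (Σ[ χ ∈ TotalColouring G 4 ] ((¬ Equitable χ) × configuration χ ≡ c))
attained-non-equitably ¬spread (G , cubic , χ , conf) =
  G , cubic , χ , ¬spread≤1⇒¬equitable {χ = χ} conf ¬spread , conf

theorem5p4 : ((G : Graph 18) → Cubic G → (χ : TotalColouring G 4) →
    configuration χ ≡ 12 ∷ 11 ∷ 11 ∷ 11 ∷ []
    ⊎ configuration χ ≡ 12 ∷ 12 ∷ 11 ∷ 10 ∷ []
    ⊎ configuration χ ≡ 12 ∷ 12 ∷ 12 ∷ 9 ∷ [])
    × (Σ[ G ∈ Graph 18 ] Cubic G × (Σ[ χ ∈ TotalColouring G 4 ] configuration χ ≡ 12 ∷ 11 ∷ 11 ∷ 11 ∷ []))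
    × (Σ[ G ∈ Graph 18 ] Cubic G × (Σ[ χ ∈ TotalColouring G 4 ] configuration χ ≡ 12 ∷ 12 ∷ 11 ∷ 10 ∷ []))
    × (Σ[ G ∈ Graph 18 ] Cubic G × (Σ[ χ ∈ TotalColouring G 4 ] configuration χ ≡ 12 ∷ 12 ∷ 12 ∷ 9 ∷ []))
    × ((c : List ℕ) →
    (Σ[ G ∈ Graph 18 ] Cubic G × (Σ[ χ ∈ TotalColouring G 4 ] ((¬ Equitable χ) × configuration χ ≡ c)))
    ⇔ (c ≡ 12 ∷ 12 ∷ 11 ∷ 10 ∷ [] ⊎ c ≡ 12 ∷ 12 ∷ 12 ∷ 9 ∷ []))
theorem5p4 =
  (λ G → configuration-admissible {G}) ,
  attained₆₄₄₄ , attained₆₆₄₂ , attained₆₆₆₀ ,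
  λ c → mk⇔
    (λ (G , cubic , χ , ¬equitable , conf) →
      subst (λ c → c ≡ 12 ∷ 12 ∷ 11 ∷ 10 ∷ [] ⊎ c ≡ 12 ∷ 12 ∷ 12 ∷ 9 ∷ []) conf
        (non-equitable-configuration {G} cubic χ ¬equitable))
    λ where
      (inj₁ refl) → attained-non-equitably (from-no (spread≤1? (12 ∷ 12 ∷ 11 ∷ 10 ∷ []))) attained₆₆₄₂
      (inj₂ refl) → attained-non-equitably (from-no (spread≤1? (12 ∷ 12 ∷ 12 ∷ 9 ∷ []))) attained₆₆₆₀
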